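{- For every $n\geq1$, the number of $\mathcal{B}_n$-orbits of acute $0/1$-triangles in $[0,1]^n$ equals $$\left\lfloor\frac{2n^3+3n^2-6n+9}{72}\right\rfloor.$$
   Context: A $0/1$-triangle in $[0,1]^n$ is the convex hull of three distinct points of $\{0,1\}^n$; it is acute if all three of its angles are strictly less than $\pi/2$. $\mathcal{B}_n$ is the hyperoctahedral group of symmetries of $[0,1]^n$ (acting on $\{0,1\}^n$ by coordinate permutations combined with complementation of a subset of coordinates); two triangles are counted as the same if one is mapped onto the other by an element of $\mathcal{B}_n$. -}

module Defs where

open import Data.Bool.Base using (Bool; true; false; _xor_)
open import Data.Bool.Properties using (xor-assoc; xor-same)
open import Data.Fin.Base using (Fin)
open import Data.Fin.Permutation as Perm
  using (Permutation′; _⟨$⟩ʳ_; _⟨$⟩ˡ_; _∘ₚ_)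
open import Data.Integer.Base using (ℤ; 0ℤ; 1ℤ; _+_; _-_; _*_; _<_)
open import Data.List.Base as List using (List; []; _∷_)
import Data.List.Properties as List
open import Data.List.Relation.Binary.BagAndSetEquality as BagSet
  using (_∼[_]_; set; [_]-Equality)
open import Data.Nat.Base using (ℕ)
open import Data.Product.Base using (Σ; ∃; _×_; _,_; proj₁)
open import Data.Vec.Base using (Vec; lookup; tabulate; zipWith; foldr′; replicate)
open import Data.Vec.Properties
  using (lookup∘tabulate; tabulate∘lookup; tabulate-cong; lookup-replicate)
open import Function.Bundles using (Bijection)
open import Level using (0ℓ)
open import Relation.Binary.Bundles using (Setoid)
open import Relation.Binary.Structures using (IsEquivalence)
open import Relation.Binary.PropositionalEquality as ≡
  using (_≡_; _≢_; refl; sym; trans; cong; cong₂; module ≡-Reasoning)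

private
  variable
    n : ℕ

Point : ℕ → Set
Point n = Vec Bool n

coord : Bool → ℤ
coord false = 0ℤ
coord true  = 1ℤ

_⟶_ : Point n → Point n → Vec ℤ n
p ⟶ q = zipWith (λ x y → coord y - coord x) p q

⟪_,_⟫ : Vec ℤ n → Vec ℤ n → ℤ
⟪ u , v ⟫ = foldr′ _+_ 0ℤ (zipWith _*_ u v)

-- A triangle is given by a listing of its vertices (the extreme points of
-- the convex hull); the order of the listing is forgotten by _≈ᵗ_ below.
record Triangle (n : ℕ) : Set where
  constructor triangle
  field
    a b c : Point n
    a≢b   : a ≢ b
    b≢c   : b ≢ c
    a≢c   : a ≢ c

  vertices : List (Point n)
  vertices = a ∷ b ∷ c ∷ []

-- The angle θ at p between the nonzero vectors u = p ⟶ q and v = p ⟶ r has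
-- cos θ = ⟪ u , v ⟫ / (∣u∣ ∣v∣), so θ < π/2 says exactly that ⟪ u , v ⟫ is
-- positive.
AcuteAngle : (p q r : Point n) → Set
AcuteAngle p q r = 0ℤ < ⟪ p ⟶ q , p ⟶ r ⟫

Acute : Triangle n → Set
Acute t = AcuteAngle a b c × AcuteAngle b c a × AcuteAngle c a b
  where open Triangle t

AcuteTriangle : ℕ → Set
AcuteTriangle n = Σ (Triangle n) Acute

-- The hyperoctahedral group: (π , s) permutes the coordinates by π and then
-- complements the coordinates i with s i = true.
ℬ : ℕ → Set
ℬ n = Permutation′ n × Vec Bool n

_·_ : ℬ n → Point n → Point n
(π , s) · x = tabulate λ i → lookup s i xor lookup x (π ⟨$⟩ˡ i)

-- g maps t onto u when the image of the vertex set of t is the vertex set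
-- of u.
_≈ᵗ_ : Triangle n → Triangle n → Set
_≈ᵗ_ {n} t u =
  ∃ λ (g : ℬ n) → List.map (g ·_) (Triangle.vertices t) ∼[ set ] Triangle.vertices u

private
  e : ℬ n
  e = Perm.id , replicate _ false

  _∙_ : ℬ n → ℬ n → ℬ n
  (π , s) ∙ (ρ , r) = ρ ∘ₚ π , (π , s) · r

  _⁻¹ : ℬ n → ℬ n
  (π , s) ⁻¹ = Perm.flip π , tabulate λ i → lookup s (π ⟨$⟩ʳ i)

  ext : {x y : Point n} → (∀ i → lookup x i ≡ lookup y i) → x ≡ y
  ext {x = x} {y} x≗y =
    trans (sym (tabulate∘lookup x)) (trans (tabulate-cong x≗y) (tabulate∘lookup y))

  e-· : (x : Point n) → e · x ≡ x
  e-· x = ext λ i → trans (lookup∘tabulate _ i)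
    (cong (_xor lookup x i) (lookup-replicate i false))

  ∙-· : (g h : ℬ n) (x : Point n) → (g ∙ h) · x ≡ g · (h · x)
  ∙-· g@(π , s) h@(ρ , r) x = tabulate-cong λ i → let j = π ⟨$⟩ˡ i in begin
    lookup (g · r) i xor lookup x (ρ ⟨$⟩ˡ j)
      ≡⟨ cong (_xor lookup x (ρ ⟨$⟩ˡ j)) (lookup∘tabulate _ i) ⟩
    (lookup s i xor lookup r j) xor lookup x (ρ ⟨$⟩ˡ j)
      ≡⟨ xor-assoc (lookup s i) (lookup r j) _ ⟩
    lookup s i xor (lookup r j xor lookup x (ρ ⟨$⟩ˡ j))
      ≡⟨ cong (lookup s i xor_) (lookup∘tabulate _ j) ⟨
    lookup s i xor lookup (h · x) j ∎
    where open ≡-Reasoning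

  ⁻¹-· : (g : ℬ n) (x : Point n) → (g ⁻¹) · (g · x) ≡ x
  ⁻¹-· g@(π , s) x = ext λ i → let j = π ⟨$⟩ʳ i in begin
    lookup ((g ⁻¹) · (g · x)) i
      ≡⟨ lookup∘tabulate _ i ⟩
    lookup (tabulate λ k → lookup s (π ⟨$⟩ʳ k)) i xor lookup (g · x) j
      ≡⟨ cong₂ _xor_ (lookup∘tabulate _ i) (lookup∘tabulate _ j) ⟩
    lookup s j xor (lookup s j xor lookup x (π ⟨$⟩ˡ j))
      ≡⟨ xor-assoc (lookup s j) (lookup s j) _ ⟨
    (lookup s j xor lookup s j) xor lookup x (π ⟨$⟩ˡ j)
      ≡⟨ cong₂ _xor_ (xor-same (lookup s j)) (cong (lookup x) (Perm.inverseˡ π)) ⟩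
    lookup x i ∎
    where open ≡-Reasoning

  module SetEq {n} = Setoid ([ set ]-Equality (Point n))

  map-∼ : (g : ℬ n) {xs ys : List (Point n)} →
          xs ∼[ set ] ys → List.map (g ·_) xs ∼[ set ] List.map (g ·_) ys
  map-∼ g = BagSet.map-cong λ _ → refl

  map-e : (xs : List (Point n)) → List.map (e ·_) xs ≡ xs
  map-e xs = trans (List.map-cong e-· xs) (List.map-id xs)

  map-∙ : (g h : ℬ n) (xs : List (Point n)) →
          List.map ((g ∙ h) ·_) xs ≡ List.map (g ·_) (List.map (h ·_) xs)
  map-∙ g h xs = trans (List.map-cong (∙-· g h) xs) (List.map-∘ xs)

  map-⁻¹ : (g : ℬ n) (xs : List (Point n)) →
           List.map ((g ⁻¹) ·_) (List.map (g ·_) xs) ≡ xs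
  map-⁻¹ g xs = trans (sym (List.map-∘ xs)) (trans (List.map-cong (⁻¹-· g) xs) (List.map-id xs))

≈ᵗ-isEquivalence : IsEquivalence (_≈ᵗ_ {n})
≈ᵗ-isEquivalence = record
  { refl  = λ {t} → e , SetEq.reflexive (map-e (Triangle.vertices t))
  ; sym   = λ { {t} (g , p) → g ⁻¹ ,
      SetEq.trans (map-∼ (g ⁻¹) (SetEq.sym p)) (SetEq.reflexive (map-⁻¹ g (Triangle.vertices t))) }
  ; trans = λ { {t} (g , p) (h , q) → h ∙ g ,
      SetEq.trans (SetEq.reflexive (map-∙ h g (Triangle.vertices t))) (SetEq.trans (map-∼ h p) q) }
  }

-- Orbits n has as its elements the ℬ n-orbits of acute triangles.
Orbits : ℕ → Setoid 0ℓ 0ℓ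
Orbits n = record
  { Carrier       = AcuteTriangle n
  ; _≈_           = λ t u → proj₁ t ≈ᵗ proj₁ u
  ; isEquivalence = record
    { refl  = λ {t} → E.refl {proj₁ t}
    ; sym   = λ {t} {u} → E.sym {proj₁ t} {proj₁ u}
    ; trans = λ {t} {u} {v} → E.trans {proj₁ t} {proj₁ u} {proj₁ v}
    }
  }
  where module E = IsEquivalence (≈ᵗ-isEquivalence {n})

HasCardinality : Setoid 0ℓ 0ℓ → ℕ → Set
HasCardinality S k = Bijection (≡.setoid (Fin k)) S

{-# OPTIONS --safe #-}
module Submission where

-- At a coordinate where the vertices of a 0/1-triangle do not all agree, exactly
-- one of them differs from the other two.  Let solo p q r be the number of
-- coordinates where p is that vertex: it is the inner product of p ⟶ q and
-- p ⟶ r, so a triangle is acute iff all three of its solo numbers are positive.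
-- These numbers determine the ordered triangle up to ℬ n.  Conversely, ℬ n acts by
-- isometries of the Hamming distance, and the sum of the distances from a vertex
-- to all vertices is its solo number plus the total S of the three; these sums
-- add up to 4 S, so an orbit determines its multiset of solo numbers.  Hence
-- orbits correspond to triples 0 < a ≤ b ≤ c with a + b + c ≤ n.  Splitting off
-- the triples with a = 1 and lowering all entries of the others by one gives a
-- recurrence in steps of 3, and two such steps give the cubic quasipolynomial.

open import Defs
open import Data.Nat using (ℕ; _+_; _*_; _^_; _∸_; _≤_)
open import Data.Nat.DivMod using (_/_)

open import Data.Bool.Base using (Bool; true; false; if_then_else_; _∧_; _xor_)
open import Data.Bool.Properties as Bool using (∧-comm; xor-same; xor-assoc; xor-comm)
open import Data.Fin.Base using (Fin; zero; suc; punchIn)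
open import Data.Fin.Permutation as Perm using (Permutation′; _⟨$⟩ʳ_; _⟨$⟩ˡ_)
open import Data.Integer.Base as ℤ using (+_; +<+)
open import Data.Integer.Properties using (drop‿+<+)
open import Data.List.Base as List using (List; []; _∷_; _++_; upTo; length)
open import Data.List.Membership.Propositional using (_∈_)
open import Data.List.Membership.Propositional.Properties
  using (∈-map⁺; ∈-map⁻; ∈-++⁺ˡ; ∈-++⁺ʳ; ∈-++⁻; ∈-upTo⁺; ∈-upTo⁻; ∈-lookup)
open import Data.List.Membership.Propositional.Properties.WithK using (unique∧set⇒bag)
import Data.List.Properties as List
open import Data.List.Relation.Binary.BagAndSetEquality
  using (bag-=⇒; ∼bag⇒↭; ↭⇒∼bag)
open import Data.List.Relation.Binary.Permutation.Propositional
  using (_↭_; prep; swap; ↭-refl; ↭-trans; ↭-reflexive; ↭⇒↭ₛ)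
import Data.List.Relation.Binary.Permutation.Propositional.Properties as ↭
open import Data.List.Relation.Binary.Pointwise using (Pointwise-≡⇒≡)
open import Data.List.Relation.Unary.All as All using ([]; _∷_)
open import Data.List.Relation.Unary.Any as Any using ()
open import Data.List.Relation.Unary.Any.Properties using (lookup-index)
open import Data.List.Relation.Unary.AllPairs using ([]; _∷_)
open import Data.List.Relation.Unary.Linked using ([-]; _∷_)
open import Data.List.Relation.Unary.Sorted.TotalOrder.Properties using (↗↭↗⇒≋)
open import Data.List.Relation.Unary.Unique.Propositional using (Unique)
import Data.List.Relation.Unary.Unique.Propositional.Properties as Unique
open import Data.Nat.Base using (zero; suc; _<_; z≤n; s≤s; z<s; s≤s⁻¹)
open import Data.Nat.Divisibility using (n∣m*n)
open import Data.Nat.DivMod using (+-distrib-/-∣ʳ; m<n⇒m/n≡0; m*n/n≡m)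
open import Data.Nat.ListAction using () renaming (sum to Σₗ)
open import Data.Nat.ListAction.Properties using (sum-↭)
open import Data.Nat.Properties
open import Data.Nat.Tactic.RingSolver using (solve-∀)
open import Data.Product.Base using (∃; ∃₂; _×_; _,_; proj₁; proj₂)
open import Data.Product.Properties using (≡-dec; ,-injectiveˡ; ,-injectiveʳ)
open import Data.Sum.Base using (inj₁; inj₂)
open import Data.Vec.Base using ([]; _∷_; lookup; tabulate)
open import Data.Vec.Properties using (lookup∘tabulate; tabulate∘lookup; tabulate-cong)
open import Function.Base using (_∘_)
open import Relation.Binary.Bundles using (Setoid)
open import Relation.Binary.Definitions using (DecidableEquality)
open import Relation.Binary.PropositionalEquality
open import Relation.Nullary using (¬_; does; yes; no; contradiction)

open import Algebra.Properties.CommutativeMonoid.Sum +-0-commutativeMonoid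
  using (sum; sum-cong-≗; sum-remove; ∑-distrib-+; sum-permute)

open ≡-Reasoning

private
  variable
    n : ℕ
    A : Set

-- Occurrence counts and permutations.

bit : Bool → ℕ
bit b = if b then 1 else 0

module Count (_≟_ : DecidableEquality A) where

  count : A → (Fin n → A) → ℕ
  count x f = sum λ i → bit (does (x ≟ f i))

  0<count⇒∃ : ∀ x (f : Fin n → A) → 0 < count x f → ∃ λ j → f j ≡ x
  0<count⇒∃ {suc n} x f 0<c with x ≟ f zero
  ... | yes x≡f₀ = zero , sym x≡f₀
  ... | no _ with j , fj≡x ← 0<count⇒∃ x (f ∘ suc) 0<c = suc j , fj≡x

  count-here : ∀ x (f : Fin (suc n) → A) → x ≡ f zero → 0 < count x f
  count-here x f x≡f₀ with x ≟ f zero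
  ... | yes _    = z<s
  ... | no x≢f₀ = contradiction x≡f₀ x≢f₀

  -- Since `h zero` has positive count in `f`, it occurs there at some `j`. Match `zero` with `j`
  -- and delete both: equal summands leave the two counts, so induction applies to the rest.
  equal-counts⇒permutation : (f h : Fin n → A) → (∀ x → count x f ≡ count x h) →
    ∃ λ (π : Permutation′ n) → ∀ i → f (π ⟨$⟩ʳ i) ≡ h i
  equal-counts⇒permutation {zero}  f h eq = Perm.id , λ ()
  equal-counts⇒permutation {suc n} f h eq
    with j , fj≡h₀ ← 0<count⇒∃ (h zero) f
           (subst (0 <_) (sym (eq (h zero))) (count-here (h zero) h refl))
    with π , fπ≗h ← equal-counts⇒permutation (f ∘ punchIn j) (h ∘ suc) (λ x →
           +-cancelˡ-≡ (bit (does (x ≟ h zero))) _ _ (begin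
             bit (does (x ≟ h zero)) + count x (f ∘ punchIn j)
               ≡⟨ cong (λ y → bit (does (x ≟ y)) + count x (f ∘ punchIn j)) fj≡h₀ ⟨
             bit (does (x ≟ f j)) + count x (f ∘ punchIn j)
               ≡⟨ sum-remove (λ i → bit (does (x ≟ f i))) ⟨
             count x f
               ≡⟨ eq x ⟩
             count x h ∎))
    = Perm.insert zero j π , λ where
        zero    → fj≡h₀
        (suc i) → trans (cong f (Perm.insert-punchIn zero j π i)) (fπ≗h i)

-- Hamming distance and solo numbers.

dist : Point n → Point n → ℕ
dist p q = sum λ i → bit (lookup p i xor lookup q i)

solo : (p q r : Point n) → ℕ
solo p q r = sum λ i → bit ((lookup p i xor lookup q i) ∧ (lookup p i xor lookup r i))

solo-swap : (p q r : Point n) → solo p q r ≡ solo p r q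
solo-swap p q r = sum-cong-≗ λ i → cong bit (∧-comm (lookup p i xor lookup q i) _)

dist-comm : (p q : Point n) → dist p q ≡ dist q p
dist-comm p q = sum-cong-≗ λ i → cong bit (xor-comm (lookup p i) (lookup q i))

dist-refl : (p : Point n) → dist p p ≡ 0
dist-refl []          = refl
dist-refl (false ∷ p) = dist-refl p
dist-refl (true  ∷ p) = dist-refl p

dist≡0⇒≡ : (p q : Point n) → dist p q ≡ 0 → p ≡ q
dist≡0⇒≡ []          []          _  = refl
dist≡0⇒≡ (false ∷ p) (false ∷ q) eq = cong (false ∷_) (dist≡0⇒≡ p q eq)
dist≡0⇒≡ (true  ∷ p) (true  ∷ q) eq = cong (true ∷_) (dist≡0⇒≡ p q eq)

-- Where `p` and `q` differ, `r` agrees with exactly one of them, and the other is the odd one out.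
dist≡solo+solo : (p q r : Point n) → dist p q ≡ solo p q r + solo q r p
dist≡solo+solo p q r = trans
  (sum-cong-≗ λ i → pointwise (lookup p i) (lookup q i) (lookup r i))
  (∑-distrib-+
    (λ i → bit ((lookup p i xor lookup q i) ∧ (lookup p i xor lookup r i)))
    (λ i → bit ((lookup q i xor lookup r i) ∧ (lookup q i xor lookup p i))))
  where
  pointwise : ∀ x y z →
    bit (x xor y) ≡ bit ((x xor y) ∧ (x xor z)) + bit ((y xor z) ∧ (y xor x))
  pointwise false false false = refl
  pointwise false false true  = refl
  pointwise false true  false = refl
  pointwise false true  true  = refl
  pointwise true  false false = refl
  pointwise true  false true  = refl
  pointwise true  true  false = refl
  pointwise true  true  true  = refl

-- If `q` and `r` both differ from `p` at a coordinate, they agree there, so the two differences are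
-- both 1 or both -1 and their product is 1. Otherwise one factor is 0.
inner-product : (p q r : Point n) → ⟪ p ⟶ q , p ⟶ r ⟫ ≡ + solo p q r
inner-product []      []      []      = refl
inner-product (x ∷ p) (y ∷ q) (z ∷ r) =
  cong₂ ℤ._+_ (pointwise x y z) (inner-product p q r)
  where
  pointwise : ∀ x y z →
    (coord y ℤ.- coord x) ℤ.* (coord z ℤ.- coord x) ≡ + bit ((x xor y) ∧ (x xor z))
  pointwise false false false = refl
  pointwise false false true  = refl
  pointwise false true  false = refl
  pointwise false true  true  = refl
  pointwise true  false false = refl
  pointwise true  false true  = refl
  pointwise true  true  false = refl
  pointwise true  true  true  = refl

acute⇒0<solo : (p q r : Point n) → AcuteAngle p q r → 0 < solo p q r
acute⇒0<solo p q r acute = drop‿+<+ (subst (ℤ.0ℤ ℤ.<_) (inner-product p q r) acute)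

0<solo⇒acute : (p q r : Point n) → 0 < solo p q r → AcuteAngle p q r
0<solo⇒acute p q r 0<s = subst (ℤ.0ℤ ℤ.<_) (sym (inner-product p q r)) (+<+ 0<s)

-- If `p` and `q` coincided, their distance 0 would have `solo p q r` as a summand. Thus the
-- distinctness demanded by `Triangle` comes from positive solo numbers.
0<solo⇒≢ : (p q r : Point n) → 0 < solo p q r → p ≢ q
0<solo⇒≢ p q r 0<s refl =
  <⇒≢ 0<s (sym (m+n≡0⇒m≡0 (solo p q r) (trans (sym (dist≡solo+solo p p r)) (dist-refl p))))

acuteTriangle : (p q r : Point n) →
  0 < solo p q r → 0 < solo q r p → 0 < solo r p q → AcuteTriangle n
acuteTriangle p q r p> q> r> =
  triangle p q r (0<solo⇒≢ p q r p>) (0<solo⇒≢ q r p q>) (≢-sym (0<solo⇒≢ r p q r>)) ,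
  0<solo⇒acute p q r p> , 0<solo⇒acute q r p q> , 0<solo⇒acute r p q r>

-- Ordered triangles up to symmetry.

-- At a coordinate where the three points do not all agree, the odd one out is
-- read off the differences of the second and third point from the first.
_≟₂_ : DecidableEquality (Bool × Bool)
_≟₂_ = ≡-dec Bool._≟_ Bool._≟_

open Count _≟₂_

differences : (p q r : Point n) → Fin n → Bool × Bool
differences p q r i = lookup p i xor lookup q i , lookup p i xor lookup r i

count-first : (p q r : Point n) → count (true , true) (differences p q r) ≡ solo p q r
count-first p q r = sum-cong-≗ λ i → cong bit (pointwise (lookup p i) (lookup q i) (lookup r i))
  where
  pointwise : ∀ x y z → does ((true , true) ≟₂ (x xor y , x xor z)) ≡ (x xor y) ∧ (x xor z)
  pointwise false false false = refl
  pointwise false false true  = refl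
  pointwise false true  false = refl
  pointwise false true  true  = refl
  pointwise true  false false = refl
  pointwise true  false true  = refl
  pointwise true  true  false = refl
  pointwise true  true  true  = refl

count-second : (p q r : Point n) → count (true , false) (differences p q r) ≡ solo q r p
count-second p q r = sum-cong-≗ λ i → cong bit (pointwise (lookup p i) (lookup q i) (lookup r i))
  where
  pointwise : ∀ x y z → does ((true , false) ≟₂ (x xor y , x xor z)) ≡ (y xor z) ∧ (y xor x)
  pointwise false false false = refl
  pointwise false false true  = refl
  pointwise false true  false = refl
  pointwise false true  true  = refl
  pointwise true  false false = refl
  pointwise true  false true  = refl
  pointwise true  true  false = refl
  pointwise true  true  true  = refl

count-third : (p q r : Point n) → count (false , true) (differences p q r) ≡ solo r p q
count-third p q r = sum-cong-≗ λ i → cong bit (pointwise (lookup p i) (lookup q i) (lookup r i))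
  where
  pointwise : ∀ x y z → does ((false , true) ≟₂ (x xor y , x xor z)) ≡ (z xor x) ∧ (z xor y)
  pointwise false false false = refl
  pointwise false false true  = refl
  pointwise false true  false = refl
  pointwise false true  true  = refl
  pointwise true  false false = refl
  pointwise true  false true  = refl
  pointwise true  true  false = refl
  pointwise true  true  true  = refl

total-count : (f : Fin n → Bool × Bool) →
  count (true , true) f + count (true , false) f + count (false , true) f
    + count (false , false) f ≡ n
total-count {zero}  f = refl
total-count {suc n} f with f zero | total-count (f ∘ suc)
... | true  , true  | eq = cong suc eq
... | true  , false | eq = trans (shift (count (true , true) (f ∘ suc)) _ _ _) (cong suc eq)
  where
  shift : ∀ a b c d → a + suc b + c + d ≡ suc (a + b + c + d)
  shift = solve-∀
... | false , true  | eq =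
  trans (shift (count (true , true) (f ∘ suc)) (count (true , false) (f ∘ suc)) _ _) (cong suc eq)
  where
  shift : ∀ a b c d → a + b + suc c + d ≡ suc (a + b + c + d)
  shift = solve-∀
... | false , false | eq = trans (+-suc _ _) (cong suc eq)

-- The last summand counts the coordinates where all three points agree. The equation recovers that
-- count from the solo numbers, and it also bounds their sum by `n`.
total-solo : (p q r : Point n) →
  solo p q r + solo q r p + solo r p q + count (false , false) (differences p q r) ≡ n
total-solo p q r
  rewrite sym (count-first p q r) | sym (count-second p q r) | sym (count-third p q r)
  = total-count (differences p q r)

equal-solos⇒equal-counts : (p q r p′ q′ r′ : Point n) →
  solo p q r ≡ solo p′ q′ r′ → solo q r p ≡ solo q′ r′ p′ → solo r p q ≡ solo r′ p′ q′ →
  ∀ x → count x (differences p q r) ≡ count x (differences p′ q′ r′)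
equal-solos⇒equal-counts p q r p′ q′ r′ eq₁ eq₂ eq₃ = λ where
  (true  , true)  → trans (count-first p q r) (trans eq₁ (sym (count-first p′ q′ r′)))
  (true  , false) → trans (count-second p q r) (trans eq₂ (sym (count-second p′ q′ r′)))
  (false , true)  → trans (count-third p q r) (trans eq₃ (sym (count-third p′ q′ r′)))
  (false , false) → +-cancelˡ-≡ (solo p q r + solo q r p + solo r p q) _ _ (begin
    solo p q r + solo q r p + solo r p q + count (false , false) (differences p q r)
      ≡⟨ trans (total-solo p q r) (sym (total-solo p′ q′ r′)) ⟩
    solo p′ q′ r′ + solo q′ r′ p′ + solo r′ p′ q′ + count (false , false) (differences p′ q′ r′)
      ≡⟨ cong (_+ count (false , false) (differences p′ q′ r′))
           (cong₂ _+_ (cong₂ _+_ eq₁ eq₂) eq₃) ⟨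
    solo p q r + solo q r p + solo r p q + count (false , false) (differences p′ q′ r′) ∎)

-- Complementing the coordinates where p permuted by π disagrees with p′ moves
-- p to p′, and with it every point in the same relative position to p as x′ to p′.
align : (p p′ : Point n) → Permutation′ n → ℬ n
align p p′ π = Perm.flip π , tabulate λ i → lookup p′ i xor lookup p (π ⟨$⟩ʳ i)

align-· : (p p′ : Point n) (π : Permutation′ n) (x x′ : Point n) →
  (∀ i → lookup p (π ⟨$⟩ʳ i) xor lookup x (π ⟨$⟩ʳ i) ≡ lookup p′ i xor lookup x′ i) →
  align p p′ π · x ≡ x′
align-· p p′ π x x′ eq = trans (tabulate-cong pointwise) (tabulate∘lookup x′)
  where
  mask = λ i → lookup p′ i xor lookup p (π ⟨$⟩ʳ i)

  pointwise : ∀ i → lookup (tabulate mask) i xor lookup x (π ⟨$⟩ʳ i) ≡ lookup x′ i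
  pointwise i = let j = π ⟨$⟩ʳ i in begin
    lookup (tabulate mask) i xor lookup x j
      ≡⟨ cong (_xor lookup x j) (lookup∘tabulate mask i) ⟩
    (lookup p′ i xor lookup p j) xor lookup x j
      ≡⟨ xor-assoc (lookup p′ i) _ _ ⟩
    lookup p′ i xor (lookup p j xor lookup x j)
      ≡⟨ cong (lookup p′ i xor_) (eq i) ⟩
    lookup p′ i xor (lookup p′ i xor lookup x′ i)
      ≡⟨ xor-assoc (lookup p′ i) _ _ ⟨
    (lookup p′ i xor lookup p′ i) xor lookup x′ i
      ≡⟨ cong (_xor lookup x′ i) (xor-same (lookup p′ i)) ⟩
    lookup x′ i ∎

-- The solo numbers fix how often each pair of differences from the first point occurs, so a
-- coordinate permutation matches the differences. Complementing coordinates then carries `p` to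
-- `p′`, and `q` and `r` follow.
equal-solos⇒same-orbit : (p q r p′ q′ r′ : Point n) →
  solo p q r ≡ solo p′ q′ r′ → solo q r p ≡ solo q′ r′ p′ → solo r p q ≡ solo r′ p′ q′ →
  ∃ λ (g : ℬ n) → g · p ≡ p′ × g · q ≡ q′ × g · r ≡ r′
equal-solos⇒same-orbit p q r p′ q′ r′ eq₁ eq₂ eq₃
  with π , f∘π≗f′ ← equal-counts⇒permutation (differences p q r) (differences p′ q′ r′)
         (equal-solos⇒equal-counts p q r p′ q′ r′ eq₁ eq₂ eq₃)
  = align p p′ π ,
    align-· p p′ π p p′ (λ i →
      trans (xor-same (lookup p (π ⟨$⟩ʳ i))) (sym (xor-same (lookup p′ i)))) ,
    align-· p p′ π q q′ (,-injectiveˡ ∘ f∘π≗f′) ,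
    align-· p p′ π r r′ (,-injectiveʳ ∘ f∘π≗f′)

-- Each unit of a solo number is spent on one coordinate where that vertex alone is `true`; on the
-- surplus coordinates all three are `false`.
points-with-solos : ∀ α β γ n → α + β + γ ≤ n →
  ∃ λ (p : Point n) → ∃₂ λ q r → solo p q r ≡ α × solo q r p ≡ β × solo r p q ≡ γ
points-with-solos zero zero zero zero _ = [] , [] , [] , refl , refl , refl
points-with-solos zero zero zero (suc n) _
  with p , q , r , α≡ , β≡ , γ≡ ← points-with-solos zero zero zero n z≤n
  = false ∷ p , false ∷ q , false ∷ r , α≡ , β≡ , γ≡
points-with-solos zero zero (suc γ) (suc n) (s≤s le)
  with p , q , r , α≡ , β≡ , γ≡ ← points-with-solos zero zero γ n le
  = false ∷ p , false ∷ q , true ∷ r , α≡ , β≡ , cong suc γ≡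
points-with-solos zero (suc β) γ (suc n) (s≤s le)
  with p , q , r , α≡ , β≡ , γ≡ ← points-with-solos zero β γ n le
  = false ∷ p , true ∷ q , false ∷ r , α≡ , cong suc β≡ , γ≡
points-with-solos (suc α) β γ (suc n) (s≤s le)
  with p , q , r , α≡ , β≡ , γ≡ ← points-with-solos α β γ n le
  = true ∷ p , false ∷ q , false ∷ r , cong suc α≡ , β≡ , γ≡

-- Invariance of the multiset of solo numbers.

·-isometry : (g : ℬ n) (x y : Point n) → dist (g · x) (g · y) ≡ dist x y
·-isometry (π , s) x y = trans
  (sum-cong-≗ λ i → cong bit (trans
    (cong₂ _xor_ (lookup∘tabulate _ i) (lookup∘tabulate _ i))
    (xor-cancel (lookup s i) (lookup x (π ⟨$⟩ˡ i)) (lookup y (π ⟨$⟩ˡ i)))))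
  (sym (sum-permute (λ i → bit (lookup x i xor lookup y i)) (Perm.flip π)))
  where
  xor-cancel : ∀ s a b → (s xor a) xor (s xor b) ≡ a xor b
  xor-cancel false a     b     = refl
  xor-cancel true  false false = refl
  xor-cancel true  false true  = refl
  xor-cancel true  true  false = refl
  xor-cancel true  true  true  = refl

·-injective : (g : ℬ n) {x y : Point n} → g · x ≡ g · y → x ≡ y
·-injective g {x} {y} gx≡gy = dist≡0⇒≡ x y (begin
  dist x y             ≡⟨ ·-isometry g x y ⟨
  dist (g · x) (g · y) ≡⟨ cong (dist (g · x)) gx≡gy ⟨
  dist (g · x) (g · x) ≡⟨ dist-refl (g · x) ⟩
  0                    ∎)

-- A solo number names the other two vertices. A distance sum depends only on a vertex and the list
-- of all of them, so it is easily carried along isometries and reorderings.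
distSum : List (Point n) → Point n → ℕ
distSum ps p = Σₗ (List.map (dist p) ps)

distSums : List (Point n) → List ℕ
distSums ps = List.map (distSum ps) ps

distSums-· : (g : ℬ n) (ps : List (Point n)) → distSums (List.map (g ·_) ps) ≡ distSums ps
distSums-· g ps = trans (sym (List.map-∘ ps)) (List.map-cong (λ p → cong Σₗ
  (trans (sym (List.map-∘ ps)) (List.map-cong (·-isometry g p) ps))) ps)

distSums-↭ : {ps qs : List (Point n)} → ps ↭ qs → distSums ps ↭ distSums qs
distSums-↭ {ps = ps} {qs} ps↭qs = ↭-trans (↭.map⁺ (distSum ps) ps↭qs)
  (↭-reflexive (List.map-cong (λ p → sum-↭ (↭.map⁺ (dist p) ps↭qs)) qs))

distSums-triangle : (p q r : Point n) → let S = solo p q r + solo q r p + solo r p q in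
  distSums (p ∷ q ∷ r ∷ []) ≡ S + solo p q r ∷ S + solo q r p ∷ S + solo r p q ∷ []
distSums-triangle p q r
  -- Distances are first put in the cyclic directions `p q`, `q r`, `r p`, so that expanding them
  -- yields only the three solo numbers of the statement.
  rewrite dist-comm p r | dist-comm q p | dist-comm r q
        | dist-refl p | dist-refl q | dist-refl r
        | dist≡solo+solo p q r | dist≡solo+solo q r p | dist≡solo+solo r p q
  = cong₂ _∷_ (first (solo p q r) _ _) (cong₂ _∷_ (second (solo p q r) _ _)
      (cong (_∷ []) (third (solo p q r) _ _)))
  where
  first : ∀ a b c → a + b + (c + a + 0) ≡ a + b + c + a
  first = solve-∀
  second : ∀ a b c → a + b + (b + c + 0) ≡ a + b + c + b
  second = solve-∀
  third : ∀ a b c → c + a + (b + c + 0) ≡ a + b + c + c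
  third = solve-∀

vertices-unique : (t : Triangle n) → Unique (Triangle.vertices t)
vertices-unique t = (a≢b ∷ a≢c ∷ []) ∷ (b≢c ∷ []) ∷ [] ∷ []
  where open Triangle t

-- `_≈ᵗ_` supplies only equality of sets. Both vertex lists are free of repetitions, the image list
-- by injectivity of the action, so the lists are permutations of each other.
≈ᵗ⇒distSums-↭ : {t u : Triangle n} → t ≈ᵗ u →
  distSums (Triangle.vertices t) ↭ distSums (Triangle.vertices u)
≈ᵗ⇒distSums-↭ {t = t} {u} (g , gt∼u) = ↭-trans
  (↭-reflexive (sym (distSums-· g (Triangle.vertices t))))
  (distSums-↭ (∼bag⇒↭ (unique∧set⇒bag
    (Unique.map⁺ (·-injective g) (vertices-unique t)) (vertices-unique u) gt∼u)))

-- Adding up each list gives `4 * S` and `4 * S′`; hence the offsets agree and cancel entrywise.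
offset-injective : ∀ {a b c a′ b′ c′} → let S = a + b + c; S′ = a′ + b′ + c′ in
  S + a ∷ S + b ∷ S + c ∷ [] ≡ S′ + a′ ∷ S′ + b′ ∷ S′ + c′ ∷ [] →
  (a , b , c) ≡ (a′ , b′ , c′)
offset-injective {a} {b} {c} {a′} {b′} {c′} eq = cong₂ _,_
  (cancel (List.∷-injectiveˡ eq))
  (cong₂ _,_ (cancel (List.∷-injectiveˡ (List.∷-injectiveʳ eq)))
             (cancel (List.∷-injectiveˡ (List.∷-injectiveʳ (List.∷-injectiveʳ eq)))))
  where
  Σ≡4S : ∀ a b c → let S = a + b + c in S + a + (S + b + (S + c + 0)) ≡ 4 * S
  Σ≡4S = solve-∀

  S≡S′ : a + b + c ≡ a′ + b′ + c′
  S≡S′ = *-cancelˡ-≡ _ _ 4 (trans (sym (Σ≡4S a b c)) (trans (cong Σₗ eq) (Σ≡4S a′ b′ c′)))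

  cancel : ∀ {x y} → a + b + c + x ≡ a′ + b′ + c′ + y → x ≡ y
  cancel {y = y} eq = +-cancelˡ-≡ (a + b + c) _ _ (trans eq (cong (_+ y) (sym S≡S′)))

solos : Triangle n → ℕ × ℕ × ℕ
solos t = solo a b c , solo b c a , solo c a b
  where open Triangle t

Ascending : ℕ × ℕ × ℕ → Set
Ascending (a , b , c) = a ≤ b × b ≤ c

-- The common offset keeps the distance sums ascending, and two sorted lists that are permutations
-- of each other are equal.
≈ᵗ⇒equal-solos : (t u : Triangle n) → Ascending (solos t) → Ascending (solos u) →
  t ≈ᵗ u → solos t ≡ solos u
≈ᵗ⇒equal-solos t u (le₁ , le₂) (le₁′ , le₂′) t≈u = offset-injective
  (Pointwise-≡⇒≡ (↗↭↗⇒≋ ≤-totalOrder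
    (+-monoʳ-≤ _ le₁ ∷ +-monoʳ-≤ _ le₂ ∷ [-])
    (+-monoʳ-≤ _ le₁′ ∷ +-monoʳ-≤ _ le₂′ ∷ [-])
    (↭⇒↭ₛ (subst₂ _↭_ (distSums-triangle t.a t.b t.c) (distSums-triangle u.a u.b u.c)
      (≈ᵗ⇒distSums-↭ {t = t} {u} t≈u)))))
  where
  module t = Triangle t
  module u = Triangle u

-- Vertices in ascending order of solo number.

record Ordering (ps : List (Point n)) : Set where
  constructor ordering
  field
    p q r : Point n
    perm  : p ∷ q ∷ r ∷ [] ↭ ps
    0<p   : 0 < solo p q r
    p≤q   : solo p q r ≤ solo q r p
    q≤r   : solo q r p ≤ solo r p q

order-last-two : (p q r : Point n) →
  0 < solo p q r → solo p q r ≤ solo q r p → solo p q r ≤ solo r p q →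
  Ordering (p ∷ q ∷ r ∷ [])
order-last-two p q r 0<p p≤q p≤r with ≤-total (solo q r p) (solo r p q)
... | inj₁ q≤r = ordering p q r ↭-refl 0<p p≤q q≤r
-- Exchanging two vertices reverses the cyclic order, which swaps the last two arguments of every
-- solo number.
... | inj₂ r≤q = ordering p r q (prep p (swap r q ↭-refl))
  (subst (0 <_) (solo-swap p q r) 0<p)
  (subst₂ _≤_ (solo-swap p q r) (solo-swap r p q) p≤r)
  (subst₂ _≤_ (solo-swap r p q) (solo-swap q r p) r≤q)

relabel : {ps qs : List (Point n)} → ps ↭ qs → Ordering ps → Ordering qs
relabel ps↭qs (ordering p q r perm 0<p p≤q q≤r) =
  ordering p q r (↭-trans perm ps↭qs) 0<p p≤q q≤r

-- Comparisons around the cycle locate a minimum. Rotating it to the front leaves the three solo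
-- terms literally unchanged, and only the other two remain to be compared.
order : (p q r : Point n) → 0 < solo p q r → 0 < solo q r p → 0 < solo r p q →
  Ordering (p ∷ q ∷ r ∷ [])
order p q r 0<p 0<q 0<r
  with ≤-total (solo p q r) (solo q r p) | ≤-total (solo q r p) (solo r p q)
     | ≤-total (solo r p q) (solo p q r)
... | inj₁ p≤q | _        | inj₂ p≤r = order-last-two p q r 0<p p≤q p≤r
... | inj₁ p≤q | _        | inj₁ r≤p =
  relabel (↭.++-comm (r ∷ []) (p ∷ q ∷ [])) (order-last-two r p q 0<r r≤p (≤-trans r≤p p≤q))
... | inj₂ q≤p | inj₁ q≤r | _        =
  relabel (↭.++-comm (q ∷ r ∷ []) (p ∷ [])) (order-last-two q r p 0<q q≤r q≤p)
... | inj₂ q≤p | inj₂ r≤q | _        =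
  relabel (↭.++-comm (r ∷ []) (p ∷ q ∷ [])) (order-last-two r p q 0<r (≤-trans r≤q q≤p) r≤q)

-- Enumeration of the triples.

pairs : ℕ → List (ℕ × ℕ)
pairs 0 = List.map (0 ,_) (upTo 1)
pairs 1 = List.map (0 ,_) (upTo 2)
pairs (suc (suc n)) =
  List.map (λ (b , c) → suc b , suc c) (pairs n) ++ List.map (0 ,_) (upTo (3 + n))

-- Lowering all entries takes 3 off the sum. A leading 1 becomes 0 and leaves a pair whose entries
-- may be 0, under the same bound `n`; this is why `pairs` starts at 0 and `triples` at 1.
triples : ℕ → List (ℕ × ℕ × ℕ)
triples 0 = []
triples 1 = []
triples 2 = []
triples (suc (suc (suc n))) =
  List.map (λ (a , b , c) → suc a , suc b , suc c) (triples n) ++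
  List.map (λ (b , c) → 1 , suc b , suc c) (pairs n)

Pair : ℕ → ℕ × ℕ → Set
Pair n (b , c) = b ≤ c × b + c ≤ n

Triple : ℕ → ℕ × ℕ × ℕ → Set
Triple n (a , b , c) = 0 < a × a ≤ b × b ≤ c × a + b + c ≤ n

suc₃ : ∀ a b c → suc a + suc b + suc c ≡ 3 + (a + b + c)
suc₃ = solve-∀

suc₂ : ∀ b c → suc b + suc c ≡ 2 + (b + c)
suc₂ = solve-∀

zero-pair : ∀ {x} → x ∈ List.map (0 ,_) (upTo (suc n)) → Pair n x
zero-pair x∈ with c , c∈ , refl ← ∈-map⁻ (0 ,_) x∈ = z≤n , s≤s⁻¹ (∈-upTo⁻ c∈)

pairs-sound : ∀ n {x} → x ∈ pairs n → Pair n x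
pairs-sound 0 x∈ = zero-pair x∈
pairs-sound 1 x∈ = zero-pair x∈
pairs-sound (suc (suc n)) x∈ with ∈-++⁻ (List.map _ (pairs n)) x∈
... | inj₂ x∈zero = zero-pair x∈zero
... | inj₁ x∈suc with (b , c) , y∈ , refl ← ∈-map⁻ _ x∈suc
                 with b≤c , le ← pairs-sound n y∈
  = s≤s b≤c , subst (_≤ 2 + n) (sym (suc₂ b c)) (s≤s (s≤s le))

pairs-complete : ∀ n {x} → Pair n x → x ∈ pairs n
pairs-complete 0 {zero , c} (_ , le) = ∈-map⁺ (0 ,_) (∈-upTo⁺ (s≤s le))
pairs-complete 1 {zero , c} (_ , le) = ∈-map⁺ (0 ,_) (∈-upTo⁺ (s≤s le))
pairs-complete (suc (suc n)) {zero , c} (_ , le) =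
  ∈-++⁺ʳ (List.map _ (pairs n)) (∈-map⁺ (0 ,_) (∈-upTo⁺ (s≤s le)))
pairs-complete n {suc b , suc c} (s≤s b≤c , le) = go n (subst (_≤ n) (suc₂ b c) le)
  where
  go : ∀ n → 2 + (b + c) ≤ n → (suc b , suc c) ∈ pairs n
  go 1 (s≤s ())
  go (suc (suc n)) (s≤s (s≤s le)) =
    ∈-++⁺ˡ (∈-map⁺ (λ (b , c) → suc b , suc c) (pairs-complete n (b≤c , le)))

triples-sound : ∀ n {x} → x ∈ triples n → Triple n x
triples-sound (suc (suc (suc n))) x∈ with ∈-++⁻ (List.map _ (triples n)) x∈
... | inj₁ x∈suc with (a , b , c) , y∈ , refl ← ∈-map⁻ _ x∈suc
                 with _ , a≤b , b≤c , le ← triples-sound n y∈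
  = z<s , s≤s a≤b , s≤s b≤c , subst (_≤ 3 + n) (sym (suc₃ a b c)) (s≤s (s≤s (s≤s le)))
... | inj₂ x∈one with (b , c) , y∈ , refl ← ∈-map⁻ _ x∈one
                 with b≤c , le ← pairs-sound n y∈
  = z<s , s≤s z≤n , s≤s b≤c , subst (_≤ 3 + n) (sym (suc₃ 0 b c)) (s≤s (s≤s (s≤s le)))

triples-complete : ∀ n {x} → Triple n x → x ∈ triples n
triples-complete n {suc a , suc b , suc c} (_ , s≤s a≤b , s≤s b≤c , le) =
  go n a a≤b (subst (_≤ n) (suc₃ a b c) le)
  where
  go : ∀ n a → a ≤ b → 3 + (a + b + c) ≤ n → (suc a , suc b , suc c) ∈ triples n
  go 1 _ _ (s≤s ())
  go 2 _ _ (s≤s (s≤s ()))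
  go (suc (suc (suc n))) zero _ (s≤s (s≤s (s≤s le))) =
    ∈-++⁺ʳ (List.map _ (triples n))
      (∈-map⁺ (λ (b , c) → 1 , suc b , suc c) (pairs-complete n (b≤c , le)))
  go (suc (suc (suc n))) (suc a) a≤b (s≤s (s≤s (s≤s le))) =
    ∈-++⁺ˡ (∈-map⁺ (λ (a , b , c) → suc a , suc b , suc c)
      (triples-complete n (z<s , a≤b , b≤c , le)))

zero-pairs-unique : ∀ n → Unique (List.map (0 ,_) (upTo n))
zero-pairs-unique n = Unique.map⁺ ,-injectiveʳ (Unique.upTo⁺ n)

pairs-unique : ∀ n → Unique (pairs n)
pairs-unique 0 = zero-pairs-unique 1
pairs-unique 1 = zero-pairs-unique 2
pairs-unique (suc (suc n)) = Unique.++⁺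
  (Unique.map⁺ (λ { refl → refl }) (pairs-unique n))
  (zero-pairs-unique (3 + n))
  disjoint
  where
  disjoint : ∀ {x} → ¬ (x ∈ List.map (λ (b , c) → suc b , suc c) (pairs n) ×
                        x ∈ List.map (0 ,_) (upTo (3 + n)))
  disjoint (x∈suc , x∈zero)
    with _ , _ , refl ← ∈-map⁻ _ x∈suc
    with () ← proj₂ (proj₂ (∈-map⁻ _ x∈zero))

triples-unique : ∀ n → Unique (triples n)
triples-unique 0 = []
triples-unique 1 = []
triples-unique 2 = []
triples-unique (suc (suc (suc n))) = Unique.++⁺
  (Unique.map⁺ (λ { refl → refl }) (triples-unique n))
  (Unique.map⁺ (λ { refl → refl }) (pairs-unique n))
  disjoint
  where
  disjoint : ∀ {x} → ¬ (x ∈ List.map (λ (a , b , c) → suc a , suc b , suc c) (triples n) ×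
                        x ∈ List.map (λ (b , c) → 1 , suc b , suc c) (pairs n))
  disjoint (x∈suc , x∈one)
    with _ , y∈ , refl ← ∈-map⁻ _ x∈suc
    with _ , _ , refl ← ∈-map⁻ _ x∈one
    -- The first entry of a common element is both 1 and the successor of an entry of a triple in
    -- `triples n`; that entry would be 0, but it is positive.
    with () ← proj₁ (triples-sound n y∈)

-- The cubic formula for the number of triples.

length-pairs : ∀ n → length (pairs (2 + n)) ≡ length (pairs n) + (3 + n)
length-pairs n = trans (List.length-++ (List.map _ (pairs n)))
  (cong₂ _+_ (List.length-map _ (pairs n))
    (trans (List.length-map {B = ℕ × ℕ} (0 ,_) (upTo (3 + n))) (List.length-upTo (3 + n))))

length-triples : ∀ n → length (triples (3 + n)) ≡ length (triples n) + length (pairs n)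
length-triples n = trans (List.length-++ (List.map _ (triples n)))
  (cong₂ _+_ (List.length-map _ (triples n)) (List.length-map _ (pairs n)))

-- The number of pairs is the quasipolynomial ⌊(n + 2)² / 4⌋; since n + 2 and
-- n + 5 have different parities, the rounding cancels in this sum.
length-pairs-sum : ∀ n → 2 * (length (pairs n) + length (pairs (3 + n))) ≡ n * n + 7 * n + 14
length-pairs-sum 0 = refl
length-pairs-sum 1 = refl
length-pairs-sum (suc (suc n)) rewrite length-pairs n | length-pairs (3 + n) =
  trans (regroup (length (pairs n)) (length (pairs (3 + n))) n)
    (trans (cong (_+ (4 * n + 18)) (length-pairs-sum n)) (square n))
  where
  regroup : ∀ x y n → 2 * (x + (3 + n) + (y + (3 + (3 + n)))) ≡ 2 * (x + y) + (4 * n + 18)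
  regroup = solve-∀
  square : ∀ n → n * n + 7 * n + 14 + (4 * n + 18) ≡ (2 + n) * (2 + n) + 7 * (2 + n) + 14
  square = solve-∀

-- The remainder r depends on n modulo 6 only.
length-triples-cubic : ∀ n → ∃ λ r → r < 72 ×
  2 * n ^ 3 + 3 * n ^ 2 + 9 ≡ r + length (triples n) * 72 + 6 * n
-- For `n` from 0 to 5 the numerators are 9, 8, 25, 72, 161, 304 and the numbers of triples are 0,
-- 0, 0, 1, 2, 4.
length-triples-cubic 0 = 9  , m<m+n 9 z<s , refl
length-triples-cubic 1 = 8  , m<m+n 8 z<s , refl
length-triples-cubic 2 = 25 , m<m+n 25 z<s , refl
length-triples-cubic 3 = 0  , m<m+n 0 z<s , refl
length-triples-cubic 4 = 17 , m<m+n 17 z<s , refl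
length-triples-cubic 5 = 16 , m<m+n 16 z<s , refl
length-triples-cubic (suc (suc (suc (suc (suc (suc n))))))
  with r , r<72 , eq ← length-triples-cubic n = r , r<72 , (begin
    2 * (6 + n) ^ 3 + 3 * (6 + n) ^ 2 + 9
      ≡⟨ shift n ⟩
    2 * n ^ 3 + 3 * n ^ 2 + 9 + 36 * (n * n + 7 * n + 14) + 36
      -- Two steps of the recurrence add `P + P′` triples, and `72 * (P + P′)` is 36 times the
      -- doubled sum known from `length-pairs-sum`.
      ≡⟨ cong₂ (λ x y → x + 36 * y + 36) eq (sym (length-pairs-sum n)) ⟩
    r + L * 72 + 6 * n + 36 * (2 * (P + P′)) + 36
      ≡⟨ regroup r L P P′ n ⟩
    r + (L + P + P′) * 72 + 6 * (6 + n)
      ≡⟨ cong (λ l → r + l * 72 + 6 * (6 + n))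
           (trans (length-triples (3 + n)) (cong (_+ P′) (length-triples n))) ⟨
    r + length (triples (6 + n)) * 72 + 6 * (6 + n) ∎)
  where
  L  = length (triples n)
  P  = length (pairs n)
  P′ = length (pairs (3 + n))
  -- _^_ is unfolded: the ring solver rejects it on a sum.
  shift : ∀ n → let m = 6 + n in
    2 * (m * (m * (m * 1))) + 3 * (m * (m * 1)) + 9 ≡
    2 * (n * (n * (n * 1))) + 3 * (n * (n * 1)) + 9 + 36 * (n * n + 7 * n + 14) + 36
  shift = solve-∀
  regroup : ∀ r l p p′ n → r + l * 72 + 6 * n + 36 * (2 * (p + p′)) + 36 ≡
    r + (l + p + p′) * 72 + 6 * (6 + n)
  regroup = solve-∀

-- The cubic identity exhibits `6 * n` as a summand of the minuend, so the truncated subtraction is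
-- exact; the remainder below 72 then vanishes in the division.
length-triples-floor : ∀ n → length (triples n) ≡ (2 * n ^ 3 + 3 * n ^ 2 + 9 ∸ 6 * n) / 72
length-triples-floor n with r , r<72 , eq ← length-triples-cubic n = sym (begin
  (2 * n ^ 3 + 3 * n ^ 2 + 9 ∸ 6 * n) / 72 ≡⟨ cong (λ x → (x ∸ 6 * n) / 72) eq ⟩
  (r + L * 72 + 6 * n ∸ 6 * n) / 72        ≡⟨ cong (_/ 72) (m+n∸n≡m (r + L * 72) (6 * n)) ⟩
  (r + L * 72) / 72                        ≡⟨ +-distrib-/-∣ʳ r (n∣m*n L) ⟩
  r / 72 + L * 72 / 72                     ≡⟨ cong₂ _+_ (m<n⇒m/n≡0 r<72) (m*n/n≡m L 72) ⟩
  L                                        ∎)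
  where
  L = length (triples n)

-- The bijection between triples and orbits.

lookup-injective : {xs : List A} → Unique xs →
  ∀ {i j} → List.lookup xs i ≡ List.lookup xs j → i ≡ j
lookup-injective (_   ∷ _) {zero}  {zero}  _  = refl
lookup-injective (x∉  ∷ _) {zero}  {suc j} eq = contradiction eq (All.lookup x∉ (∈-lookup j))
lookup-injective (x∉  ∷ _) {suc i} {zero}  eq = contradiction (sym eq) (All.lookup x∉ (∈-lookup i))
lookup-injective (_   ∷ u) {suc i} {suc j} eq = cong suc (lookup-injective u eq)

-- `f` may depend on the membership proof. Surjectivity is therefore asked for all proofs at once,
-- since the one produced by `∈-lookup` need not be the one at hand.
enumeration⇒cardinality : (S : Setoid _ _) {xs : List A} → Unique xs →
  let open Setoid S in
  (f : ∀ {x} → x ∈ xs → Carrier) →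
  (∀ {x y} (x∈ : x ∈ xs) (y∈ : y ∈ xs) → f x∈ ≈ f y∈ → x ≡ y) →
  (∀ s → ∃ λ x → x ∈ xs × (∀ (x∈ : x ∈ xs) → f x∈ ≈ s)) →
  HasCardinality S (length xs)
enumeration⇒cardinality S {xs} unique f injective surjective = record
  { to        = λ i → f (∈-lookup i)
  ; cong      = λ { refl → S.refl }
  ; bijective =
      (λ {i} {j} eq → lookup-injective unique (injective (∈-lookup i) (∈-lookup j) eq)) ,
      λ s → let x , x∈ , f≈s = surjective s in
        Any.index x∈ , λ { refl → at (lookup-index x∈) f≈s (∈-lookup (Any.index x∈)) }
  }
  where
  module S = Setoid S
  at : ∀ {x y s} → x ≡ y → (∀ (x∈ : x ∈ xs) → f x∈ S.≈ s) → ∀ (y∈ : y ∈ xs) → f y∈ S.≈ s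
  at refl f≈s = f≈s

triangle-of : ∀ {x} → Triple n x → AcuteTriangle n
triangle-of {n} {α , β , γ} (0<α , α≤β , β≤γ , le)
  -- Matching on the equations turns `α`, `β`, `γ` into the solo numbers themselves, so the
  -- inequalities of the triple apply to them directly.
  with p , q , r , refl , refl , refl ← points-with-solos α β γ n le
  = acuteTriangle p q r 0<α (≤-trans 0<α α≤β) (≤-trans 0<α (≤-trans α≤β β≤γ))

solos-triangle-of : ∀ {x} (T : Triple n x) → solos (proj₁ (triangle-of T)) ≡ x
solos-triangle-of {n} {α , β , γ} (_ , _ , _ , le)
  with p , q , r , refl , refl , refl ← points-with-solos α β γ n le = refl

triangle-of-injective : ∀ {x y} (T : Triple n x) (U : Triple n y) →
  proj₁ (triangle-of T) ≈ᵗ proj₁ (triangle-of U) → x ≡ y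
triangle-of-injective {x = x} {y} T U T≈U = begin
  x       ≡⟨ solos-triangle-of T ⟨
  solos t ≡⟨ ≈ᵗ⇒equal-solos t u (ascending T) (ascending U) T≈U ⟩
  solos u ≡⟨ solos-triangle-of U ⟩
  y       ∎
  where
  t = proj₁ (triangle-of T)
  u = proj₁ (triangle-of U)

  ascending : ∀ {x} (T : Triple _ x) → Ascending (solos (proj₁ (triangle-of T)))
  ascending T@(_ , α≤β , β≤γ , _) = subst Ascending (sym (solos-triangle-of T)) (α≤β , β≤γ)

-- The triple consists of the solo numbers of the sorted vertices. Its representative has the same
-- numbers in the same order, so a group element carries it onto the sorted vertices, a permutation
-- of those of `t`.
triangle-of-surjective : (t : AcuteTriangle n) →
  ∃ λ x → Triple n x × (∀ (T : Triple n x) → proj₁ (triangle-of T) ≈ᵗ proj₁ t)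
triangle-of-surjective (triangle a b c _ _ _ , acute-a , acute-b , acute-c)
  with ordering p q r perm 0<p p≤q q≤r ← order a b c
         (acute⇒0<solo a b c acute-a) (acute⇒0<solo b c a acute-b) (acute⇒0<solo c a b acute-c)
  = (solo p q r , solo q r p , solo r p q) ,
    (0<p , p≤q , q≤r , m+n≤o⇒m≤o _ (≤-reflexive (total-solo p q r))) ,
    λ T → let
      open Triangle (proj₁ (triangle-of T)) using () renaming (a to p′; b to q′; c to r′)
      eq = solos-triangle-of T
      g , gp≡ , gq≡ , gr≡ = equal-solos⇒same-orbit p′ q′ r′ p q r
        (cong proj₁ eq) (cong (proj₁ ∘ proj₂) eq) (cong (proj₂ ∘ proj₂) eq)
      in g , bag-=⇒ (↭⇒∼bag (↭-trans
        (↭-reflexive (cong₂ _∷_ gp≡ (cong₂ _∷_ gq≡ (cong (_∷ []) gr≡)))) perm))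

theorem4p23 : (n : ℕ) → 1 ≤ n →
    HasCardinality (Orbits n) ((2 * n ^ 3 + 3 * n ^ 2 + 9 ∸ 6 * n) / 72)
theorem4p23 n _ = subst (HasCardinality (Orbits n)) (length-triples-floor n)
  (enumeration⇒cardinality (Orbits n) (triples-unique n)
    (triangle-of ∘ triples-sound n)
    (λ x∈ y∈ → triangle-of-injective (triples-sound n x∈) (triples-sound n y∈))
    (λ t → let x , T , T≈t = triangle-of-surjective t in
      x , triples-complete n T , T≈t ∘ triples-sound n))
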